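{- Let $G$ be a simple, connected graph on $n\ge 2$ vertices and $m\ge 1$ edges, let $\{u,v\}\in E(G)$ and $i\in V(G)$. If $d(i,u)=d(i,v)$ and $\gamma_{i\to u}$ is a shortest walk from vertex $i$ to vertex $u$, then there exists a shortest walk $\gamma'_{i\to v}$ from vertex $i$ to vertex $v$ such that $\gamma'_{i\to v}\cup\gamma_{i\to u}\cup\{u,v\}$ forms an odd unicyclic subgraph of $G$.
   Context: $G$ is a finite undirected graph and $d$ is the usual graph distance. The union $\gamma'_{i\to v}\cup\gamma_{i\to u}\cup\{u,v\}$ is the subgraph of $G$ consisting of the vertices and edges traversed by the two walks together with the edge $\{u,v\}$. An odd unicyclic graph is a connected graph with exactly one cycle, that cycle having odd length. -}

module Defs where

open import Data.Nat.Base using (ℕ; zero; suc; _+_; _*_; _≤_; _≥_; z≤n; s≤s)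
open import Data.Fin.Base as Fin using (Fin)
import Data.Fin.Properties as Fin
open import Data.List.Base using (List; []; _∷_; length; filter; allFin; cartesianProduct)
open import Data.List.Membership.Propositional using (_∈_)
open import Data.List.Relation.Unary.Unique.Propositional using (Unique)
open import Data.List.Relation.Unary.Any using (here; there)
open import Data.Product.Base using (Σ-syntax; ∃; _×_; _,_; proj₁; proj₂)
open import Data.Sum.Base using (_⊎_; inj₁; inj₂; swap)
import Data.Sum.Base as Sum
open import Function.Base using (_∘_)
open import Function.Bundles using (_⇔_)
open import Level using (0ℓ)
open import Relation.Binary.Core using (Rel)
open import Relation.Binary.Definitions using (Symmetric; Irreflexive; Decidable)
open import Relation.Binary.PropositionalEquality using (_≡_; refl; cong)
open import Relation.Nullary using (yes; no; contradiction)
open import Relation.Nullary.Decidable using (_×-dec_; map′)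
import Relation.Unary as U

-- Finite simple undirected graphs with vertex set Fin n.  Decidability of
-- adjacency is part of what it means for the graph to be finite.
record Graph (n : ℕ) : Set₁ where
  field
    Adj    : Rel (Fin n) 0ℓ
    symm   : Symmetric Adj
    irrefl : Irreflexive _≡_ Adj
    adj?   : Decidable Adj

open Graph public

-- Each edge {x , y} is counted once, as the pair with x < y.
edgeCount : ∀ {n} → Graph n → ℕ
edgeCount {n} G = length (filter edge? (cartesianProduct (allFin n) (allFin n)))
  where
  edge? : U.Decidable λ (x , y) → x Fin.< y × Adj G x y
  edge? (x , y) = (x Fin.<? y) ×-dec adj? G x y

Odd : ℕ → Set
Odd k = ∃ λ j → k ≡ 1 + 2 * j

data Walk {V : Set} (R : Rel V 0ℓ) : Rel V 0ℓ where
  []  : ∀ {x} → Walk R x x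
  _∷_ : ∀ {x y z} → R x y → Walk R y z → Walk R x z

module _ {V : Set} {R : Rel V 0ℓ} where

  len : ∀ {x y} → Walk R x y → ℕ
  len []      = 0
  len (_ ∷ w) = suc (len w)

  -- All vertices of the walk except its initial one.
  targets : ∀ {x y} → Walk R x y → List V
  targets []                = []
  targets (_∷_ {y = y} _ w) = y ∷ targets w

  vertices : ∀ {x y} → Walk R x y → List V
  vertices {x} w = x ∷ targets w

  steps : ∀ {x y} → Walk R x y → List (V × V)
  steps []                = []
  steps (_∷_ {x} {y} _ w) = (x , y) ∷ steps w

  -- The walk uses the undirected edge {a , b}.
  Traverses : ∀ {x y} → Walk R x y → Rel V 0ℓ
  Traverses w a b = (a , b) ∈ steps w ⊎ (b , a) ∈ steps w

  Shortest : ∀ {x y} → Walk R x y → Set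
  Shortest {x} {y} w = (w′ : Walk R x y) → len w ≤ len w′

Connected : ∀ {n} → Graph n → Set
Connected G = ∀ x y → Walk (Adj G) x y

least : {P : U.Pred ℕ 0ℓ} → U.Decidable P → ∀ k → P k →
        Σ[ m ∈ ℕ ] P m × (∀ j → P j → m ≤ j)
least P? zero    p = zero , p , λ _ _ → z≤n
least P? (suc k) p with P? zero
... | yes p₀ = zero , p₀ , λ _ _ → z≤n
... | no ¬p₀ with least (P? ∘ suc) k p
...   | m , pm , min = suc m , pm , λ where
        zero    p₀ → contradiction p₀ ¬p₀
        (suc j) pj → s≤s (min j pj)

module _ {n : ℕ} (G : Graph n) where

  WalkOfLength : Fin n → Fin n → ℕ → Set
  WalkOfLength x y k = Σ[ w ∈ Walk (Adj G) x y ] len w ≡ k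

  walkOfLength? : ∀ x y → U.Decidable (WalkOfLength x y)
  walkOfLength? x y zero = map′ (λ { refl → [] , refl }) (λ { ([] , _) → refl }) (x Fin.≟ y)
  walkOfLength? x y (suc k) = map′
    (λ { (_ , e , w , eq) → e ∷ w , cong suc eq })
    (λ { (e ∷ w , refl) → _ , e , w , refl })
    (Fin.any? λ z → adj? G x z ×-dec walkOfLength? z y k)

  module _ (conn : Connected G) (x y : Fin n) where

    private
      minimum = least (walkOfLength? x y) (len (conn x y)) (conn x y , refl)

    -- Graph distance: the least length of a walk from x to y.  The walk
    -- provided by conn only bounds the search.
    dist : ℕ
    dist = proj₁ minimum

    dist-attained : WalkOfLength x y dist
    dist-attained = proj₁ (proj₂ minimum)

    dist-minimal : (w : Walk (Adj G) x y) → dist ≤ len w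
    dist-minimal w = proj₂ (proj₂ minimum) (len w) (w , refl)

record Subgraph {n : ℕ} (G : Graph n) : Set₁ where
  field
    V     : U.Pred (Fin n) 0ℓ
    E     : Rel (Fin n) 0ℓ
    E-sym : Symmetric E
    E⇒V   : ∀ {x y} → E x y → V x
    E⇒Adj : ∀ {x y} → E x y → Adj G x y

open Subgraph public

module _ {n : ℕ} {G : Graph n} where

  infixr 6 _∪_

  _∪_ : Subgraph G → Subgraph G → Subgraph G
  H ∪ K = record
    { V     = λ x → V H x ⊎ V K x
    ; E     = λ x y → E H x y ⊎ E K x y
    ; E-sym = Sum.map (E-sym H) (E-sym K)
    ; E⇒V   = Sum.map (E⇒V H) (E⇒V K)
    ; E⇒Adj = Sum.[ E⇒Adj H , E⇒Adj K ]
    }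

  private
    step-source : ∀ {x y a b} (w : Walk (Adj G) x y) → (a , b) ∈ steps w → a ∈ vertices w
    step-source (_ ∷ w) (here refl) = here refl
    step-source (_ ∷ w) (there p)   = there (step-source w p)

    step-target : ∀ {x y a b} (w : Walk (Adj G) x y) → (a , b) ∈ steps w → b ∈ vertices w
    step-target (_ ∷ w) (here refl) = there (here refl)
    step-target (_ ∷ w) (there p)   = there (step-target w p)

    step-adj : ∀ {x y a b} (w : Walk (Adj G) x y) → (a , b) ∈ steps w → Adj G a b
    step-adj (e ∷ w) (here refl) = e
    step-adj (_ ∷ w) (there p)   = step-adj w p

  walkSubgraph : ∀ {x y} → Walk (Adj G) x y → Subgraph G
  walkSubgraph w = record
    { V     = _∈ vertices w
    ; E     = Traverses w
    ; E-sym = swap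
    ; E⇒V   = Sum.[ step-source w , step-target w ]
    ; E⇒Adj = Sum.[ step-adj w , symm G ∘ step-adj w ]
    }

  edgeSubgraph : ∀ {u v} → Adj G u v → Subgraph G
  edgeSubgraph {u} {v} e = record
    { V     = λ x → x ≡ u ⊎ x ≡ v
    ; E     = λ x y → (x ≡ u × y ≡ v) ⊎ (x ≡ v × y ≡ u)
    ; E-sym = λ { (inj₁ (p , q)) → inj₂ (q , p) ; (inj₂ (p , q)) → inj₁ (q , p) }
    ; E⇒V   = Sum.map proj₁ proj₁
    ; E⇒Adj = λ { (inj₁ (refl , refl)) → e ; (inj₂ (refl , refl)) → symm G e }
    }

  ConnectedSubgraph : Subgraph G → Set
  ConnectedSubgraph H = ∀ {x y} → V H x → V H y → Walk (E H) x y

  -- A closed walk of length at least 3 in which only the initial and final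
  -- vertices coincide.
  record Cycle (H : Subgraph G) : Set where
    field
      base     : Fin n
      walk     : Walk (E H) base base
      length≥3 : len walk ≥ 3
      distinct : Unique (targets walk)

  open Cycle public

  -- Closed walks differing by base point or orientation represent the same
  -- cycle, so cycles are compared by their edge sets.
  SameCycle : {H : Subgraph G} → Rel (Cycle H) 0ℓ
  SameCycle C D = ∀ x y → Traverses (walk C) x y ⇔ Traverses (walk D) x y

  OddUnicyclic : Subgraph G → Set
  OddUnicyclic H = ConnectedSubgraph H
    × Σ[ C ∈ Cycle H ] (∀ D → SameCycle C D) × Odd (len (walk C))

{-# OPTIONS --safe #-}
-- Take any shortest walk from i to v, let a be the last vertex it shares with γ,
-- and let γ′ follow γ up to a.  Levels, i.e. distances from i, grow by one along
-- both walks, so after a they never meet again and have equal length k; with the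
-- edge uv they close up to a cycle C of length 2k + 1, with the common part as a
-- pendant stem.  In a cycle every vertex has two distinct neighbours.  Hence no
-- cycle D enters the stem, so D ⊆ C; and an edge of C lying in D forces the next
-- one to lie in D as well, so C ⊆ D.
module Submission where

open import Data.Nat.Base using (ℕ; suc; _+_; _*_; _≤_; _<_; _≥_; z≤n; s≤s)
open import Data.Nat.Properties
open import Data.Fin.Base using (Fin)
import Data.Fin.Properties as Fin
open import Data.List.Base using ([]; _∷_; _++_)
open import Data.List.Membership.Propositional using (_∈_; _∉_)
open import Data.List.Membership.Propositional.Properties using (∈-++⁺ˡ; ∈-++⁺ʳ; ∈-++⁻)
open import Data.List.Relation.Binary.Disjoint.Propositional using (Disjoint)
open import Data.List.Relation.Unary.All using (All; []; _∷_; lookup)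
open import Data.List.Relation.Unary.All.Properties using (¬Any⇒All¬)
open import Data.List.Relation.Unary.AllPairs using ([]; _∷_)
open import Data.List.Relation.Unary.Any using (here; there)
open import Data.List.Relation.Unary.Unique.Propositional using (Unique)
open import Data.List.Relation.Unary.Unique.Propositional.Properties using (++⁺)
open import Data.Product.Base using (Σ-syntax; ∃; _×_; _,_; proj₂)
open import Data.Sum.Base using (_⊎_; inj₁; inj₂; swap)
import Data.Sum.Base as Sum
open import Function.Base using (_∘_)
open import Function.Bundles using (mk⇔)
open import Level using (0ℓ)
open import Relation.Binary.Core using (Rel; _⇒_)
open import Relation.Binary.Definitions using (Symmetric; DecidableEquality)
open import Relation.Binary.PropositionalEquality using (_≡_; _≢_; refl; sym; trans; cong; subst; module ≡-Reasoning)
open import Relation.Nullary using (¬_; yes; no; contradiction)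
open import Defs

-- Concatenation of walks and the edges they traverse

module _ {V : Set} {R : Rel V 0ℓ} where

  infixr 5 _++ʷ_

  _++ʷ_ : ∀ {x y z} → Walk R x y → Walk R y z → Walk R x z
  []      ++ʷ w′ = w′
  (e ∷ w) ++ʷ w′ = e ∷ (w ++ʷ w′)

  len-++ʷ : ∀ {x y z} (w : Walk R x y) (w′ : Walk R y z) → len (w ++ʷ w′) ≡ len w + len w′
  len-++ʷ []      w′ = refl
  len-++ʷ (e ∷ w) w′ = cong suc (len-++ʷ w w′)

  steps-++ʷ : ∀ {x y z} (w : Walk R x y) (w′ : Walk R y z) → steps (w ++ʷ w′) ≡ steps w ++ steps w′
  steps-++ʷ []      w′ = refl
  steps-++ʷ (e ∷ w) w′ = cong (_ ∷_) (steps-++ʷ w w′)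

  targets-++ʷ : ∀ {x y z} (w : Walk R x y) (w′ : Walk R y z) →
                targets (w ++ʷ w′) ≡ targets w ++ targets w′
  targets-++ʷ []      w′ = refl
  targets-++ʷ (e ∷ w) w′ = cong (_ ∷_) (targets-++ʷ w w′)

  traverses-++ʷ⁻ : ∀ {x y z} (w : Walk R x y) (w′ : Walk R y z) →
                   ∀ {p q} → Traverses (w ++ʷ w′) p q → Traverses w p q ⊎ Traverses w′ p q
  traverses-++ʷ⁻ w w′ t rewrite steps-++ʷ w w′ with t
  ... | inj₁ s = Sum.map inj₁ inj₁ (∈-++⁻ (steps w) s)
  ... | inj₂ s = Sum.map inj₂ inj₂ (∈-++⁻ (steps w) s)

  traverses-++ʷ⁺ˡ : ∀ {x y z} (w : Walk R x y) (w′ : Walk R y z) → Traverses w ⇒ Traverses (w ++ʷ w′)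
  traverses-++ʷ⁺ˡ w w′ t rewrite steps-++ʷ w w′ = Sum.map ∈-++⁺ˡ ∈-++⁺ˡ t

  traverses-++ʷ⁺ʳ : ∀ {x y z} (w : Walk R x y) (w′ : Walk R y z) → Traverses w′ ⇒ Traverses (w ++ʷ w′)
  traverses-++ʷ⁺ʳ w w′ t rewrite steps-++ʷ w w′ = Sum.map (∈-++⁺ʳ (steps w)) (∈-++⁺ʳ (steps w)) t

  step-source : ∀ {x y a b} (w : Walk R x y) → (a , b) ∈ steps w → a ∈ vertices w
  step-source (_ ∷ w) (here refl) = here refl
  step-source (_ ∷ w) (there s)   = there (step-source w s)

  step-target : ∀ {x y a b} (w : Walk R x y) → (a , b) ∈ steps w → b ∈ targets w
  step-target (_ ∷ w) (here refl) = here refl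
  step-target (_ ∷ w) (there s)   = there (step-target w s)

  traverses-source : ∀ {x y a b} (w : Walk R x y) → Traverses w a b → a ∈ vertices w
  traverses-source w (inj₁ s) = step-source w s
  traverses-source w (inj₂ s) = there (step-target w s)

  traverses⇒ : ∀ {x y} (w : Walk R x y) → Symmetric R → Traverses w ⇒ R
  traverses⇒ (e ∷ w) R-sym (inj₁ (here refl)) = e
  traverses⇒ (e ∷ w) R-sym (inj₂ (here refl)) = R-sym e
  traverses⇒ (e ∷ w) R-sym (inj₁ (there s))   = traverses⇒ w R-sym (inj₁ s)
  traverses⇒ (e ∷ w) R-sym (inj₂ (there s))   = traverses⇒ w R-sym (inj₂ s)
  traverses⇒ []      R-sym (inj₁ ())
  traverses⇒ []      R-sym (inj₂ ())

  first-edge : ∀ {x y} (w : Walk R x y) → len w ≥ 1 → ∃ λ p → ∃ λ q → Traverses w p q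
  first-edge (e ∷ w) _ = _ , _ , inj₁ (here refl)

  end∈vertices : ∀ {x y} (w : Walk R x y) → y ∈ vertices w
  end∈vertices []      = here refl
  end∈vertices (_ ∷ w) = there (end∈vertices w)

  -- Reversal of walks

  module _ (R-sym : Symmetric R) where

    reverseʷ : ∀ {x y} → Walk R x y → Walk R y x
    reverseʷ []      = []
    reverseʷ (e ∷ w) = reverseʷ w ++ʷ (R-sym e ∷ [])

    len-reverseʷ : ∀ {x y} (w : Walk R x y) → len (reverseʷ w) ≡ len w
    len-reverseʷ []      = refl
    len-reverseʷ (e ∷ w) = begin
      len (reverseʷ w ++ʷ (R-sym e ∷ [])) ≡⟨ len-++ʷ (reverseʷ w) _ ⟩
      len (reverseʷ w) + 1                ≡⟨ +-comm _ 1 ⟩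
      suc (len (reverseʷ w))              ≡⟨ cong suc (len-reverseʷ w) ⟩
      suc (len w)                         ∎
      where open ≡-Reasoning

    traverses-reverseʷ⁻ : ∀ {x y} (w : Walk R x y) → Traverses (reverseʷ w) ⇒ Traverses w
    traverses-reverseʷ⁻ []      t = t
    traverses-reverseʷ⁻ (e ∷ w) t with traverses-++ʷ⁻ (reverseʷ w) _ t
    ... | inj₁ t′               = Sum.map there there (traverses-reverseʷ⁻ w t′)
    ... | inj₂ (inj₁ (here refl)) = inj₂ (here refl)
    ... | inj₂ (inj₂ (here refl)) = inj₁ (here refl)

    traverses-reverseʷ⁺ : ∀ {x y} (w : Walk R x y) → Traverses w ⇒ Traverses (reverseʷ w)
    traverses-reverseʷ⁺ [] t = t
    traverses-reverseʷ⁺ (e ∷ w) (inj₁ (here refl)) =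
      traverses-++ʷ⁺ʳ (reverseʷ w) (R-sym e ∷ []) (inj₂ (here refl))
    traverses-reverseʷ⁺ (e ∷ w) (inj₂ (here refl)) =
      traverses-++ʷ⁺ʳ (reverseʷ w) (R-sym e ∷ []) (inj₁ (here refl))
    traverses-reverseʷ⁺ (e ∷ w) (inj₁ (there s)) =
      traverses-++ʷ⁺ˡ (reverseʷ w) (R-sym e ∷ []) (traverses-reverseʷ⁺ w (inj₁ s))
    traverses-reverseʷ⁺ (e ∷ w) (inj₂ (there s)) =
      traverses-++ʷ⁺ˡ (reverseʷ w) (R-sym e ∷ []) (traverses-reverseʷ⁺ w (inj₂ s))

    vertices-reverseʷ⁻ : ∀ {x y z} (w : Walk R x y) → z ∈ vertices (reverseʷ w) → z ∈ vertices w
    vertices-reverseʷ⁻ []      p = p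
    vertices-reverseʷ⁻ (e ∷ w) p
      rewrite targets-++ʷ (reverseʷ w) (R-sym e ∷ [])
      with ∈-++⁻ (vertices (reverseʷ w)) p
    ... | inj₁ p′          = there (vertices-reverseʷ⁻ w p′)
    ... | inj₂ (here refl) = here refl

    unique-reverseʷ : ∀ {x y} (w : Walk R x y) → Unique (vertices w) → Unique (vertices (reverseʷ w))
    unique-reverseʷ []      uq       = uq
    unique-reverseʷ (e ∷ w) (x∉ ∷ uq)
      rewrite targets-++ʷ (reverseʷ w) (R-sym e ∷ []) =
      ++⁺ (unique-reverseʷ w uq) ([] ∷ [])
        λ { (p , here refl) → lookup x∉ (vertices-reverseʷ⁻ w p) refl }

  -- Successors and predecessors of steps in paths and closed walks

  step-next : ∀ {x y p q} (w : Walk R x y) → (p , q) ∈ steps w → q ≡ y ⊎ ∃ λ r → (q , r) ∈ steps w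
  step-next (e ∷ [])     (here refl) = inj₁ refl
  step-next (e ∷ f ∷ w)  (here refl) = inj₂ (_ , there (here refl))
  step-next (e ∷ w)      (there s)   with step-next w s
  ... | inj₁ q≡y      = inj₁ q≡y
  ... | inj₂ (r , s′) = inj₂ (r , there s′)

  step-prev : ∀ {x y p q} (w : Walk R x y) → (p , q) ∈ steps w → p ≡ x ⊎ ∃ λ r → (r , p) ∈ steps w
  step-prev (e ∷ w) (here refl) = inj₁ refl
  step-prev (e ∷ w) (there s)   with step-prev w s
  ... | inj₁ refl     = inj₂ (_ , here refl)
  ... | inj₂ (r , s′) = inj₂ (r , there s′)

  last-step : ∀ {x y z} (e : R x y) (w : Walk R y z) → ∃ λ r → (r , z) ∈ steps (e ∷ w)
  last-step e []      = _ , here refl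
  last-step e (f ∷ w) with last-step f w
  ... | r , s = r , there s

  step-functional : ∀ {x y p q q′} (w : Walk R x y) → Unique (vertices w) →
                    (p , q) ∈ steps w → (p , q′) ∈ steps w → q ≡ q′
  step-functional (e ∷ w) uq        (here refl) (here refl) = refl
  step-functional (e ∷ w) (x∉ ∷ _)  (here refl) (there s′)  = contradiction refl (lookup x∉ (step-source w s′))
  step-functional (e ∷ w) (x∉ ∷ _)  (there s)   (here refl) = contradiction refl (lookup x∉ (step-source w s))
  step-functional (e ∷ w) (_ ∷ uq)  (there s)   (there s′)  = step-functional w uq s s′

  -- A step is determined by where its end sits in `targets w`. The initial vertex may recur, so the
  -- lemma also applies to closed walks.
  step-injective : ∀ {x y p p′ q} (w : Walk R x y) → Unique (targets w) →
                   (p , q) ∈ steps w → (p′ , q) ∈ steps w → p ≡ p′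
  step-injective (e ∷ w) uq        (here refl) (here refl) = refl
  step-injective (e ∷ w) (y∉ ∷ _)  (here refl) (there s′)  = contradiction refl (lookup y∉ (step-target w s′))
  step-injective (e ∷ w) (y∉ ∷ _)  (there s)   (here refl) = contradiction refl (lookup y∉ (step-target w s))
  step-injective (e ∷ w) (_ ∷ uq)  (there s)   (there s′)  = step-injective w uq s s′

  no-step-from-end : ∀ {x y q} (w : Walk R x y) → Unique (vertices w) → (y , q) ∉ steps w
  no-step-from-end (e ∷ w) (x∉ ∷ _) (here refl) = lookup x∉ (end∈vertices w) refl
  no-step-from-end (e ∷ w) (_ ∷ uq) (there s)   = no-step-from-end w uq s

  path-no-backtrack : ∀ {x y p q} (w : Walk R x y) → Unique (vertices w) →
                      (p , q) ∈ steps w → (q , p) ∉ steps w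
  path-no-backtrack (e ∷ w) (x∉ ∷ _) (here refl) (here refl) = lookup x∉ (here refl) refl
  path-no-backtrack (e ∷ w) (x∉ ∷ _) (here refl) (there s′)  = lookup x∉ (there (step-target w s′)) refl
  path-no-backtrack (e ∷ w) (x∉ ∷ _) (there s)   (here refl) = lookup x∉ (there (step-target w s)) refl
  path-no-backtrack (e ∷ w) (_ ∷ uq) (there s)   (there s′)  = path-no-backtrack w uq s s′

  closed-next : ∀ {b p q} (c : Walk R b b) → (p , q) ∈ steps c → ∃ λ r → (q , r) ∈ steps c
  closed-next c@(e ∷ w) s with step-next c s
  ... | inj₁ refl = _ , here refl
  ... | inj₂ next = next

  closed-prev : ∀ {b p q} (c : Walk R b b) → (p , q) ∈ steps c → ∃ λ r → (r , p) ∈ steps c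
  closed-prev c@(e ∷ w) s with step-prev c s
  ... | inj₁ refl = last-step e w
  ... | inj₂ prev = prev

  -- For `e ∷ w` the hypothesis is literally `Unique (vertices w)`, so `w` is a path. It ends at the
  -- base point and never leaves it, hence `e` is the only step starting there.
  closed-functional : ∀ {b p q q′} (c : Walk R b b) → Unique (targets c) →
                      (p , q) ∈ steps c → (p , q′) ∈ steps c → q ≡ q′
  closed-functional (e ∷ w) uq (here refl) (here refl) = refl
  closed-functional (e ∷ w) uq (here refl) (there s′)  = contradiction s′ (no-step-from-end w uq)
  closed-functional (e ∷ w) uq (there s)   (here refl) = contradiction s (no-step-from-end w uq)
  closed-functional (e ∷ w) uq (there s)   (there s′)  = step-functional w uq s s′

  first-step≢end : ∀ {x y} (w : Walk R x y) → len w ≥ 2 → Unique (vertices w) → (x , y) ∉ steps w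
  first-step≢end (e ∷ [])    (s≤s ()) _ _
  first-step≢end (e ∷ f ∷ w) _ (_ ∷ y∉ ∷ _) (here refl) = lookup y∉ (end∈vertices w) refl
  first-step≢end (e ∷ f ∷ w) _ (x∉ ∷ _)     (there s)   = lookup x∉ (step-source (f ∷ w) s) refl

  -- A closed walk of length 2 goes along an edge and back, hence the length bound. Reversing the
  -- first step inside `w` would be a step from the start of that path to its end, which a path of
  -- length at least 2 lacks.
  closed-no-backtrack : ∀ {b p q} (c : Walk R b b) → len c ≥ 3 → Unique (targets c) →
                        (p , q) ∈ steps c → (q , p) ∉ steps c
  closed-no-backtrack (e ∷ [])    (s≤s ()) uq (here refl) (here refl)
  closed-no-backtrack (e ∷ f ∷ w) l (y∉ ∷ _)  (here refl) (here refl) = lookup y∉ (end∈vertices w) refl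
  closed-no-backtrack (e ∷ w) (s≤s l) uq (here refl) (there s′)  = first-step≢end w l uq s′
  closed-no-backtrack (e ∷ w) (s≤s l) uq (there s)   (here refl) = first-step≢end w l uq s
  closed-no-backtrack (e ∷ w) l       uq (there s)   (there s′)  = path-no-backtrack w uq s s′

  -- Transfer of a walk to another relation containing its steps

  lift : ∀ {Q : Rel V 0ℓ} {x y} (w : Walk R x y) → (∀ {p q} → (p , q) ∈ steps w → Q p q) → Walk Q x y
  lift []      f = []
  lift (e ∷ w) f = f (here refl) ∷ lift w (f ∘ there)

  module _ {Q : Rel V 0ℓ} where

    len-lift : ∀ {x y} (w : Walk R x y) (f : ∀ {p q} → (p , q) ∈ steps w → Q p q) → len (lift w f) ≡ len w
    len-lift []      f = refl
    len-lift (e ∷ w) f = cong suc (len-lift w (f ∘ there))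

    targets-lift : ∀ {x y} (w : Walk R x y) (f : ∀ {p q} → (p , q) ∈ steps w → Q p q) →
                   targets (lift w f) ≡ targets w
    targets-lift []      f = refl
    targets-lift (e ∷ w) f = cong (_ ∷_) (targets-lift w (f ∘ there))

    steps-lift : ∀ {x y} (w : Walk R x y) (f : ∀ {p q} → (p , q) ∈ steps w → Q p q) →
                 steps (lift w f) ≡ steps w
    steps-lift []      f = refl
    steps-lift (e ∷ w) f = cong (_ ∷_) (steps-lift w (f ∘ there))

    lift-initial : ∀ {x y z} (w : Walk R x y) → (∀ {p q} → (p , q) ∈ steps w → Q p q) →
                   z ∈ vertices w → Walk Q x z
    lift-initial w       f (here refl) = []
    lift-initial (e ∷ w) f (there p)   = f (here refl) ∷ lift-initial w (f ∘ there) p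

-- Relations without vertices of degree one

MinDegree2 : ∀ {V : Set} → Rel V 0ℓ → Set
MinDegree2 S = ∀ {x y} → S x y → ∃ λ z → z ≢ y × S x z

module _ {V : Set} {R : Rel V 0ℓ} where

  -- The predecessor and the successor of a vertex on the cycle are its two neighbours. They differ
  -- because no step is ever reversed.
  closed-minDegree2 : ∀ {b} (c : Walk R b b) → len c ≥ 3 → Unique (targets c) → MinDegree2 (Traverses c)
  closed-minDegree2 c l uq (inj₁ s) with closed-prev c s
  ... | z , s′ = z , (λ { refl → closed-no-backtrack c l uq s s′ }) , inj₂ s′
  closed-minDegree2 c l uq (inj₂ s) with closed-next c s
  ... | z , s′ = z , (λ { refl → closed-no-backtrack c l uq s s′ }) , inj₁ s′

  module _ {S : Rel V 0ℓ} where

    StepClosed : ∀ {x y} → Walk R x y → Set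
    StepClosed w = ∀ {p q r} → (p , q) ∈ steps w → (q , r) ∈ steps w → S p q → S q r

    spread-to-end : ∀ {x y p q} (w : Walk R x y) → StepClosed w →
                    (p , q) ∈ steps w → S p q → ∃ λ r → (r , y) ∈ steps w × S r y
    spread-to-end (e ∷ [])    cl (here refl) t = _ , here refl , t
    spread-to-end (e ∷ f ∷ w) cl (here refl) t
      with spread-to-end (f ∷ w) (λ s s′ → cl (there s) (there s′)) (here refl)
             (cl (here refl) (there (here refl)) t)
    ... | r , s , t′ = r , there s , t′
    spread-to-end (e ∷ w) cl (there s) t
      with spread-to-end w (λ s s′ → cl (there s) (there s′)) s t
    ... | r , s′ , t′ = r , there s′ , t′

    spread-from-start : ∀ {x y} (w : Walk R x y) → StepClosed w →
                        (∀ {z} → (x , z) ∈ steps w → S x z) → ∀ {p q} → (p , q) ∈ steps w → S p q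
    spread-from-start (e ∷ w) cl first (here refl) = first (here refl)
    spread-from-start (e ∷ w) cl first (there s)   =
      spread-from-start w (λ s s′ → cl (there s) (there s′))
        (λ s → cl (here refl) (there s) (first (here refl))) s

    -- An edge of `S` on `c` can only be continued along `c`, so `S` travels forward from any one of
    -- its edges until it has gone all the way round.
    minDegree2-fills-closed : ∀ {b} (c : Walk R b b) → Unique (targets c) →
                              Symmetric S → MinDegree2 S → S ⇒ Traverses c →
                              ∀ {p q} → S p q → Traverses c ⇒ S
    minDegree2-fills-closed c uq S-sym deg S⊆c t₀ = λ { (inj₁ s) → all-steps s ; (inj₂ s) → S-sym (all-steps s) }
      where
      closed : StepClosed c
      -- The second `S`-neighbour `z` of the common vertex is reached along `c` either forwards,
      -- where it must be the next vertex, or backwards, where it would be `p` again.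
      closed {p} s s′ t with deg (S-sym t)
      ... | z , z≢p , t′ with S⊆c t′
      ...   | inj₁ s″ = subst (S _) (closed-functional c uq s″ s′) t′
      ...   | inj₂ s″ = contradiction (step-injective c uq s″ s) z≢p

      some-step : ∃ λ p → ∃ λ q → (p , q) ∈ steps c × S p q
      some-step with S⊆c t₀
      ... | inj₁ s = _ , _ , s , t₀
      ... | inj₂ s = _ , _ , s , S-sym t₀

      all-steps : ∀ {p q} → (p , q) ∈ steps c → S p q
      all-steps with some-step
      ... | _ , _ , s , t with spread-to-end c closed s t
      -- `closed` does not ask the two steps to be consecutive in the list. It also applies to the
      -- last step into the base point followed by the first one out, which carries `S` over the
      -- seam.
      ...   | r , s′ , t′ = spread-from-start c closed λ s″ → closed s′ s″ t′

-- Walks along which a level function grows by one at each step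

module _ {V : Set} {R : Rel V 0ℓ} (h : V → ℕ) where

  Ascending : ∀ {x y} → Walk R x y → Set
  Ascending w = All (λ (p , q) → h q ≡ suc (h p)) (steps w)

  ascending-++ʷ : ∀ {x y z} (w : Walk R x y) {w′ : Walk R y z} →
                  Ascending w → Ascending w′ → Ascending (w ++ʷ w′)
  ascending-++ʷ []      []        as′ = as′
  ascending-++ʷ (e ∷ w) (eq ∷ as) as′ = eq ∷ ascending-++ʷ w as as′

  ascending-len : ∀ {x y} (w : Walk R x y) → Ascending w → h x + len w ≡ h y
  ascending-len {x} []      []        = +-identityʳ (h x)
  ascending-len {x} {z} (_∷_ {y = y} e w) (eq ∷ as) = begin
    h x + suc (len w) ≡⟨ +-suc (h x) (len w) ⟩
    suc (h x) + len w ≡⟨ cong (_+ len w) (sym eq) ⟩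
    h y + len w       ≡⟨ ascending-len w as ⟩
    h z               ∎
    where open ≡-Reasoning

  ascending-vertices : ∀ {x y z} (w : Walk R x y) → Ascending w → z ∈ vertices w → h x ≤ h z
  ascending-targets  : ∀ {x y z} (w : Walk R x y) → Ascending w → z ∈ targets w → h x < h z

  ascending-vertices w as (here refl) = ≤-refl
  ascending-vertices w as (there p)   = <⇒≤ (ascending-targets w as p)

  ascending-targets (e ∷ w) (eq ∷ as) p = ≤-trans (≤-reflexive (sym eq)) (ascending-vertices w as p)

  -- Every later vertex lies strictly above the starting one.
  ascending-unique : ∀ {x y} (w : Walk R x y) → Ascending w → Unique (vertices w)
  ascending-unique []      []            = [] ∷ []
  ascending-unique (e ∷ w) as@(_ ∷ as′) =
    ¬Any⇒All¬ _ (λ p → <-irrefl refl (ascending-targets (e ∷ w) as p)) ∷ ascending-unique w as′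

  -- The lowest vertex of the stem has only one neighbour left, so the stem can
  -- be peeled off from its start.
  prune-stem : ∀ {S T : Rel V 0ℓ} {x a} (σ : Walk R x a) → Ascending σ →
               (∀ {p q} → T p q → h a ≤ h p) → MinDegree2 S →
               (∀ {p q} → S p q → Traverses σ p q ⊎ T p q) → Symmetric S → S ⇒ T
  prune-stem [] as above deg S⊆ S-sym t with S⊆ t
  ... | inj₁ (inj₁ ())
  ... | inj₁ (inj₂ ())
  ... | inj₂ t′ = t′
  prune-stem {S} {T} {x} {a} (_∷_ {y = y} e σ) as@(eq ∷ as′) above deg S⊆ S-sym =
    prune-stem σ as′ above deg S⊆σ S-sym
    where
    x∉σ : x ∉ vertices σ
    x∉σ p = <-irrefl refl (ascending-targets (e ∷ σ) as p)

    only-y : ∀ {z} → S x z → z ≡ y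
    only-y t with S⊆ t
    ... | inj₁ (inj₁ (here refl)) = refl
    ... | inj₁ (inj₂ (here refl)) = contradiction (here refl) x∉σ
    ... | inj₁ (inj₁ (there s))   = contradiction (traverses-source σ (inj₁ s)) x∉σ
    ... | inj₁ (inj₂ (there s))   = contradiction (traverses-source σ (inj₂ s)) x∉σ
    -- `x` lies strictly below `a`, whereas `T` has edges only from level `h a` upwards.
    ... | inj₂ t′ = contradiction (ascending-targets (e ∷ σ) as (end∈vertices σ)) (≤⇒≯ (above t′))

    isolated : ∀ {z} → ¬ S x z
    isolated t with deg t
    ... | z′ , z′≢z , t′ = z′≢z (trans (only-y t′) (sym (only-y t)))

    S⊆σ : ∀ {p q} → S p q → Traverses σ p q ⊎ T p q
    S⊆σ t with S⊆ t
    ... | inj₁ (inj₁ (here refl)) = contradiction t isolated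
    ... | inj₁ (inj₂ (here refl)) = contradiction (S-sym t) isolated
    ... | inj₁ (inj₁ (there s))   = inj₁ (inj₁ s)
    ... | inj₁ (inj₂ (there s))   = inj₁ (inj₂ s)
    ... | inj₂ t′                 = inj₂ t′

  -- The given walk `γ` is kept whole and merely split at `apex`. A second walk contributes only
  -- `right`, since its beginning is to be replaced by `stem`. Disjointness concerns `targets`
  -- because both branches start at `apex`.
  record Fork {x u} (γ : Walk R x u) (v : V) : Set where
    field
      {apex}    : V
      stem      : Walk R x apex
      left      : Walk R apex u
      right     : Walk R apex v
      γ≡        : γ ≡ stem ++ʷ left
      stem-asc  : Ascending stem
      left-asc  : Ascending left
      right-asc : Ascending right
      disjoint  : Disjoint (targets left) (targets right)

  module _ (_≟_ : DecidableEquality V) where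

    -- Both walks start at the same level, so they can meet only at equal positions. The recursion
    -- treats the tails first, so the apex found is the last meeting point. The starting points may
    -- differ, as the tails of two walks with a common start need not start together.
    fork-or-disjoint : ∀ {x x′ u v} (α : Walk R x u) (β : Walk R x′ v) →
                       Ascending α → Ascending β → h x ≡ h x′ → len α ≡ len β → u ≢ v →
                       Fork α v ⊎ Disjoint (vertices α) (vertices β)
    fork-or-disjoint [] [] [] [] _ _ u≢v =
      inj₂ λ { (here refl , here refl) → u≢v refl }
    fork-or-disjoint {x} {x′} (e ∷ α) (f ∷ β) asα@(eq ∷ as) asβ@(eq′ ∷ as′) hx lens u≢v
      with fork-or-disjoint α β as as′ (trans eq (trans (cong suc hx) (sym eq′))) (suc-injective lens) u≢v
    ... | inj₁ F = inj₁ record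
      { Fork F hiding (stem; γ≡; stem-asc)
      ; stem = e ∷ Fork.stem F
      ; γ≡ = cong (e ∷_) (Fork.γ≡ F)
      ; stem-asc = eq ∷ Fork.stem-asc F
      }
    ... | inj₂ disj with x ≟ x′
    ...   | yes refl = inj₁ record
      { stem = [] ; left = e ∷ α ; right = f ∷ β ; γ≡ = refl
      ; stem-asc = [] ; left-asc = asα ; right-asc = asβ ; disjoint = disj }
    -- In the mixed cases a start would recur among the targets of the other walk, all of which lie
    -- at a higher level.
    ...   | no x≢x′ = inj₂ λ where
      (here refl , here refl) → x≢x′ refl
      (here refl , there q)   → <-irrefl (sym hx) (ascending-targets (f ∷ β) asβ q)
      (there p   , here refl) → <-irrefl hx (ascending-targets (e ∷ α) asα p)
      (there p   , there q)   → disj (p , q)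

    fork : ∀ {x u v} (α : Walk R x u) (β : Walk R x v) → Ascending α → Ascending β →
           len α ≡ len β → u ≢ v → Fork α v
    fork α β as as′ lens u≢v with fork-or-disjoint α β as as′ refl lens u≢v
    ... | inj₁ F    = F
    ... | inj₂ disj = contradiction (here refl , here refl) disj

-- The subgraph formed by a fork and the edge joining its tips

module _ {n : ℕ} (G : Graph n) where

  module _ (h : Fin n → ℕ) {i a u v : Fin n} (uv : Adj G u v) (hu≡hv : h u ≡ h v)
           (σ : Walk (Adj G) i a) (α : Walk (Adj G) a u) (β : Walk (Adj G) a v)
           (σ-asc : Ascending h σ) (α-asc : Ascending h α) (β-asc : Ascending h β)
           (disj : Disjoint (targets α) (targets β)) where

    private
      H : Subgraph G
      H = walkSubgraph (σ ++ʷ β) ∪ walkSubgraph (σ ++ʷ α) ∪ edgeSubgraph uv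

      β⁻¹ : Walk (Adj G) v a
      β⁻¹ = reverseʷ (symm G) β

      c : Walk (Adj G) a a
      c = α ++ʷ (uv ∷ β⁻¹)

      -- The length of an ascending walk is the difference of the levels of its ends, and `u` and
      -- `v` have the same level.
      lens : len α ≡ len β
      lens = +-cancelˡ-≡ (h a) _ _
        (trans (ascending-len h α α-asc) (trans hu≡hv (sym (ascending-len h β β-asc))))

      len-c : len c ≡ 1 + 2 * len α
      len-c = begin
        len c                     ≡⟨ len-++ʷ α _ ⟩
        len α + suc (len β⁻¹)     ≡⟨ cong (λ k → len α + suc k) (len-reverseʷ (symm G) β) ⟩
        len α + suc (len β)       ≡⟨ cong (λ k → len α + suc k) (sym lens) ⟩
        len α + suc (len α)       ≡⟨ +-suc (len α) (len α) ⟩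
        1 + (len α + len α)       ≡⟨ cong (λ k → 1 + (len α + k)) (sym (+-identityʳ (len α))) ⟩
        1 + 2 * len α             ∎
        where open ≡-Reasoning

      u≢v : u ≢ v
      u≢v u≡v = irrefl G u≡v uv

      -- If `α` were empty, so would be `β`, and `u` and `v` would both be `a`.
      len-α≥1 : len α ≥ 1
      len-α≥1 = nonempty α β lens
        where
        nonempty : (α : Walk (Adj G) a u) (β : Walk (Adj G) a v) → len α ≡ len β → len α ≥ 1
        nonempty []      [] _ = contradiction refl u≢v
        nonempty (_ ∷ _) _  _ = s≤s z≤n

      c≥3 : len c ≥ 3
      c≥3 = subst (_≥ 3) (sym len-c) (s≤s (*-monoʳ-≤ 2 len-α≥1))

      -- The list is `targets α` followed by `vertices β⁻¹`. The base point `a` occurs only at its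
      -- very end, as the last vertex of `β⁻¹`.
      c-unique : Unique (targets c)
      c-unique rewrite targets-++ʷ α (uv ∷ β⁻¹) with ascending-unique h α α-asc
      ... | _ ∷ α-unique = ++⁺ α-unique (unique-reverseʷ (symm G) β (ascending-unique h β β-asc))
        λ (p , q) → off-β p (vertices-reverseʷ⁻ (symm G) β q)
        where
        off-β : ∀ {z} → z ∈ targets α → z ∉ vertices β
        off-β p (here refl) = <-irrefl refl (ascending-targets h α α-asc p)
        off-β p (there q)   = disj (p , q)

      c⁻ : ∀ {p q} → Traverses c p q → Traverses α p q ⊎ Traverses β p q ⊎ E (edgeSubgraph {G = G} uv) p q
      c⁻ t with traverses-++ʷ⁻ α (uv ∷ β⁻¹) t
      ... | inj₁ t′                 = inj₁ t′
      ... | inj₂ (inj₁ (here refl)) = inj₂ (inj₂ (inj₁ (refl , refl)))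
      ... | inj₂ (inj₂ (here refl)) = inj₂ (inj₂ (inj₂ (refl , refl)))
      ... | inj₂ (inj₁ (there s))   = inj₂ (inj₁ (traverses-reverseʷ⁻ (symm G) β (inj₁ s)))
      ... | inj₂ (inj₂ (there s))   = inj₂ (inj₁ (traverses-reverseʷ⁻ (symm G) β (inj₂ s)))

      c⊆H : Traverses c ⇒ E H
      c⊆H t with c⁻ t
      ... | inj₁ t′        = inj₂ (inj₁ (traverses-++ʷ⁺ʳ σ α t′))
      ... | inj₂ (inj₁ t′) = inj₁ (traverses-++ʷ⁺ʳ σ β t′)
      ... | inj₂ (inj₂ e)  = inj₂ (inj₂ e)

      H⊆σ∪c : ∀ {p q} → E H p q → Traverses σ p q ⊎ Traverses c p q
      H⊆σ∪c (inj₁ t) = Sum.map₂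
        (traverses-++ʷ⁺ʳ α (uv ∷ β⁻¹) ∘ Sum.map there there ∘ traverses-reverseʷ⁺ (symm G) β)
        (traverses-++ʷ⁻ σ β t)
      H⊆σ∪c (inj₂ (inj₁ t)) = Sum.map₂ (traverses-++ʷ⁺ˡ α (uv ∷ β⁻¹)) (traverses-++ʷ⁻ σ α t)
      H⊆σ∪c (inj₂ (inj₂ (inj₁ (refl , refl)))) =
        inj₂ (traverses-++ʷ⁺ʳ α (uv ∷ β⁻¹) (inj₁ (here refl)))
      H⊆σ∪c (inj₂ (inj₂ (inj₂ (refl , refl)))) =
        inj₂ (traverses-++ʷ⁺ʳ α (uv ∷ β⁻¹) (inj₂ (here refl)))

      -- This is what allows `prune-stem` to peel off `σ`: the cycle meets no level below that of
      -- `a`.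
      c-above : ∀ {p q} → Traverses c p q → h a ≤ h p
      c-above t with c⁻ t
      ... | inj₁ t′        = ascending-vertices h α α-asc (traverses-source α t′)
      ... | inj₂ (inj₁ t′) = ascending-vertices h β β-asc (traverses-source β t′)
      ... | inj₂ (inj₂ (inj₁ (refl , refl))) = ascending-vertices h α α-asc (end∈vertices α)
      ... | inj₂ (inj₂ (inj₂ (refl , refl))) = ascending-vertices h β β-asc (end∈vertices β)

      c-in-H : ∀ {p q} → (p , q) ∈ steps c → E H p q
      c-in-H s = c⊆H (inj₁ s)

      C : Cycle H
      C = record
        { base     = a
        ; walk     = lift c c-in-H
        ; length≥3 = subst (_≥ 3) (sym (len-lift c c-in-H)) c≥3
        ; distinct = subst Unique (sym (targets-lift c c-in-H)) c-unique
        }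

      c⊆C : Traverses c ⇒ Traverses (walk C)
      c⊆C t rewrite steps-lift c c-in-H = t

      C⊆c : Traverses (walk C) ⇒ Traverses c
      C⊆c t rewrite steps-lift c c-in-H = t

      same : ∀ D → SameCycle C D
      same D x y = mk⇔
        (minDegree2-fills-closed (walk C) (distinct C) swap D-deg D⊆C
          -- Any edge of `D` will do as the seed; its length bound guarantees that there is one.
          (proj₂ (proj₂ (first-edge (walk D) (≤-trans (s≤s z≤n) (length≥3 D))))))
        D⊆C
        where
        D-deg : MinDegree2 (Traverses (walk D))
        D-deg = closed-minDegree2 (walk D) (length≥3 D) (distinct D)

        D⊆C : Traverses (walk D) ⇒ Traverses (walk C)
        -- The edges of `D` lie in `H`, that is, on the stem or on `c`, and pruning leaves only `c`.
        D⊆C = c⊆C ∘ prune-stem h σ σ-asc c-above D-deg (H⊆σ∪c ∘ traverses⇒ (walk D) (E-sym H)) swap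

      -- Initial segments of the two walks from `i` reach every vertex of `H`, because `u` and `v`
      -- are their ends. Connectedness follows by passing through `i`.
      from-i : ∀ {x} → V H x → Walk (E H) i x
      from-i (inj₁ p)        = lift-initial (σ ++ʷ β) (λ s → inj₁ (inj₁ s)) p
      from-i (inj₂ (inj₁ p)) = lift-initial (σ ++ʷ α) (λ s → inj₂ (inj₁ (inj₁ s))) p
      from-i (inj₂ (inj₂ (inj₁ refl))) = from-i (inj₂ (inj₁ (end∈vertices (σ ++ʷ α))))
      from-i (inj₂ (inj₂ (inj₂ refl))) = from-i (inj₁ (end∈vertices (σ ++ʷ β)))

    fork-oddUnicyclic : OddUnicyclic {G = G} H
    fork-oddUnicyclic =
        (λ p q → reverseʷ (E-sym H) (from-i p) ++ʷ from-i q)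
      , C , same , len α , trans (len-lift c c-in-H) len-c

  -- Distance from a fixed vertex as the level function

  module _ (conn : Connected G) (i : Fin n) where

    private
      h : Fin n → ℕ
      h = dist G conn i

    dist-triangle : ∀ {x y} (w : Walk (Adj G) x y) → h y ≤ h x + len w
    dist-triangle {x} {y} w with dist-attained G conn i x
    ... | w₀ , eq = begin
      h y            ≤⟨ dist-minimal G conn i y (w₀ ++ʷ w) ⟩
      len (w₀ ++ʷ w) ≡⟨ len-++ʷ w₀ w ⟩
      len w₀ + len w ≡⟨ cong (_+ len w) eq ⟩
      h x + len w    ∎
      where open ≤-Reasoning

    dist-refl : h i ≡ 0
    dist-refl = n≤0⇒n≡0 (dist-minimal G conn i i [])

    -- The first step raises the level by at most 1 and the rest by at most its length. Equality in
    -- total forces equality in both.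
    tight-ascending : ∀ {x y} (w : Walk (Adj G) x y) → h x + len w ≡ h y → Ascending h w
    tight-ascending []      _ = []
    tight-ascending {x} {z} (_∷_ {y = y} e w) eq = hy ∷ tight-ascending w (trans (cong (_+ len w) hy) eq′)
      where
      eq′ : suc (h x) + len w ≡ h z
      eq′ = trans (sym (+-suc (h x) (len w))) eq

      hy : h y ≡ suc (h x)
      hy = ≤-antisym
        (≤-trans (dist-triangle (e ∷ [])) (≤-reflexive (+-comm (h x) 1)))
        (+-cancelʳ-≤ (len w) _ _ (≤-trans (≤-reflexive eq′) (dist-triangle w)))

    dist-ascending : ∀ {y} (w : Walk (Adj G) i y) → len w ≡ h y → Ascending h w
    dist-ascending w eq = tight-ascending w (trans (cong (_+ len w) dist-refl) eq)

    -- Level 0 at `i` makes the length of an ascending walk equal to the distance of its end.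
    ascending-shortest : ∀ {y} (w : Walk (Adj G) i y) → Ascending h w → Shortest w
    ascending-shortest {y} w as w′ = begin
      len w       ≡⟨ cong (_+ len w) (sym dist-refl) ⟩
      h i + len w ≡⟨ ascending-len h w as ⟩
      h y         ≤⟨ dist-minimal G conn i y w′ ⟩
      len w′      ∎
      where open ≤-Reasoning

    shortest-len : ∀ {y} (w : Walk (Adj G) i y) → Shortest w → len w ≡ h y
    shortest-len {y} w sh with dist-attained G conn i y
    ... | w₀ , eq = ≤-antisym (≤-trans (sh w₀) (≤-reflexive eq)) (dist-minimal G conn i y w)

lemma2p4 : (n m : ℕ) (G : Graph n) → n ≥ 2 → edgeCount G ≡ m → m ≥ 1 →
    (conn : Connected G) (u v : Fin n) (uv : Adj G u v) (i : Fin n) →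
    dist G conn i u ≡ dist G conn i v →
    (γ : Walk (Adj G) i u) → Shortest γ →
    Σ[ γ′ ∈ Walk (Adj G) i v ] Shortest γ′ ×
    OddUnicyclic {G = G} (walkSubgraph γ′ ∪ walkSubgraph γ ∪ edgeSubgraph uv)
lemma2p4 n m G _ _ _ conn u v uv i du≡dv γ γ-shortest
  with dist-attained G conn i v
... | δ , δ-len
  -- `δ` is an arbitrary shortest walk to `v`; equality of the two distances gives it the same
  -- length as `γ`.
  with fork h Fin._≟_ γ δ (dist-ascending G conn i γ γ-len) (dist-ascending G conn i δ δ-len)
         (trans γ-len (trans du≡dv (sym δ-len))) (λ u≡v → irrefl G u≡v uv)
  where
  h : Fin n → ℕ
  h = dist G conn i

  γ-len : len γ ≡ h u
  γ-len = shortest-len G conn i γ γ-shortest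
... | record { stem = σ ; left = α ; right = β ; γ≡ = refl
             ; stem-asc = σ-asc ; left-asc = α-asc ; right-asc = β-asc ; disjoint = disj } =
    -- Matching `γ≡` with `refl` has turned `γ` into `σ ++ʷ α`, so the new walk shares exactly the
    -- stem with it. Being ascending, it is again shortest.
    σ ++ʷ β
  , ascending-shortest G conn i (σ ++ʷ β) (ascending-++ʷ (dist G conn i) σ σ-asc β-asc)
  , fork-oddUnicyclic G (dist G conn i) uv du≡dv σ α β σ-asc α-asc β-asc disj
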